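{- Let $n\ge 3$. For every $1\le k< n-1$ we have $Kf(Q_{n,k})<Kf(Q_{n,k+1})$; that is, for fixed $n$, the Kirchhoff index of the enhanced hypercube $Q_{n,k}$ is increasing in $k\in\{1,\dots,n-1\}$.
   Context: For $n\ge 2$ and $1\le k\le n-1$, the enhanced hypercube $Q_{n,k}$ is the simple graph whose vertices are the binary strings $x_1x_2\cdots x_n$ ($x_i\in\{0,1\}$), where $X=x_1\cdots x_n$ and $Y$ are adjacent iff either $Y$ is obtained from $X$ by complementing exactly one coordinate ($1\le i\le n$), or $Y=x_1\cdots x_{k-1}\overline{x_k}\,\overline{x_{k+1}}\cdots\overline{x_n}$. For a connected graph $\Gamma$, the resistance distance $r_{ij}$ between vertices $v_i,v_j$ is the effective resistance between them when every edge is a unit resistor, and the Kirchhoff index is $Kf(\Gamma)=\sum_{i<j} r_{ij}$. -}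

module Defs where

open import Data.Bool using (Bool; true; false; not; if_then_else_; _∨_)
import Data.Bool as B
open import Data.Nat using (ℕ; zero; suc; _≤ᵇ_)
open import Data.Fin using (Fin; toℕ)
open import Data.Vec using (Vec; []; _∷_; lookup; tabulate; _[_]%=_)
open import Data.Vec.Properties using (≡-dec)
open import Data.List using (List; []; _∷_; [_]; map; _++_; foldr)
open import Data.Bool.ListAction using (any)
open import Data.List using (allFin)
open import Data.Product using (Σ; _×_; _,_; ∃)
open import Data.Rational using (ℚ; 0ℚ; 1ℚ; _+_; _-_)
open import Relation.Nullary.Decidable using (⌊_⌋)
open import Relation.Binary.PropositionalEquality using (_≡_)

-- Vertices of Q_{n,k}: binary strings x_1 ... x_n, coordinate x_{i+1} is
-- the entry at position i : Fin n.
Vertex : ℕ → Set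
Vertex n = Vec Bool n

verts : (n : ℕ) → List (Vertex n)
verts zero = [ [] ]
verts (suc n) = map (false ∷_) (verts n) ++ map (true ∷_) (verts n)

_==_ : ∀ {n} → Vertex n → Vertex n → Bool
u == v = ⌊ ≡-dec B._≟_ u v ⌋

flipAt : ∀ {n} → Fin n → Vertex n → Vertex n
flipAt i v = v [ i ]%= not

-- complement coordinates x_k, x_{k+1}, ..., x_n (1-based)
compFrom : ∀ {n} → ℕ → Vertex n → Vertex n
compFrom k v = tabulate (λ i → if k ≤ᵇ suc (toℕ i) then not (lookup v i) else lookup v i)

adj : ∀ {n} → ℕ → Vertex n → Vertex n → Bool
adj {n} k x y = any (λ i → flipAt i x == y) (allFin n) ∨ (compFrom k x == y)

sumℚ : List ℚ → ℚ
sumℚ = foldr _+_ 0ℚ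

laplacian : (n k : ℕ) → (Vertex n → ℚ) → Vertex n → ℚ
laplacian n k x v = sumℚ (map (λ u → if adj k v u then x v - x u else 0ℚ) (verts n))

indicator : ∀ {n} → Vertex n → Vertex n → ℚ
indicator a v = if v == a then 1ℚ else 0ℚ

-- r is the effective resistance between a and b in Q_{n,k} (unit resistors):
-- there is a vertex-potential x realising a unit current entering at a and
-- leaving at b (Kirchhoff current law + Ohm's law: L x = e_a - e_b), and r is the
-- resulting potential difference x(a) - x(b).
IsResistance : (n k : ℕ) → Vertex n → Vertex n → ℚ → Set
IsResistance n k a b r =
  Σ (Vertex n → ℚ) λ x →
    ((v : Vertex n) → laplacian n k x v ≡ (indicator a v - indicator b v))
    × (r ≡ x a - x b)

IsResistanceFn : (n k : ℕ) → (Vertex n → Vertex n → ℚ) → Set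
IsResistanceFn n k r = (a b : Vertex n) → IsResistance n k a b (r a b)

pairs : ∀ {A : Set} → List A → List (A × A)
pairs [] = []
pairs (x ∷ xs) = map (x ,_) xs ++ pairs xs

kirchhoff : (n : ℕ) → (Vertex n → Vertex n → ℚ) → ℚ
kirchhoff n r = sumℚ (map (λ p → r (Data.Product.proj₁ p) (Data.Product.proj₂ p)) (pairs (verts n)))

-- The Laplacian of Q_{n,k} is diagonalised by the characters χ_s of (ℤ/2)ⁿ, with eigenvalue
-- 2(|s| + [|s ∩ {k,…,n}| odd]).  Its inverse on the nontrivial characters gives potentials,
-- and symmetry of the Laplacian makes the resistance independent of the potential chosen, so
-- Kf is a positive multiple of Σ_{s≠0} 1/(|s| + [|s ∩ {k,…,n}| odd]).  Passing from k to k + 1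
-- only affects the s containing k, and changes the sum by sums of terms
-- ± (1/(m+1) − 1/(m+2)) that assemble into iterated differences of 1/(m+1), which are positive.

module Submission where

open import Defs
open import Data.Nat using (ℕ; suc; _≤_; _<_)
open import Data.Rational using (ℚ) renaming (_<_ to _<ℚ_)
open import Data.Product using (_×_; ∃)

open import Data.Bool using (Bool; true; false; not; if_then_else_; _∧_; _∨_; _xor_)
import Data.Bool as Bool
open import Data.Bool.ListAction using (any; or)
open import Data.Bool.Properties using (∨-comm; not-involutive)
open import Data.Fin using (Fin)
open import Data.List using (List; []; _∷_; map; _++_; allFin; tabulate)
open import Data.List.Properties using (map-∘; map-cong; map-tabulate)
open import Data.List.Relation.Unary.All as All using (All; []; _∷_)
import Data.List.Relation.Unary.All.Properties as All
open import Data.List.Relation.Unary.AllPairs using ([]; _∷_)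
open import Data.List.Relation.Unary.Unique.Propositional using (Unique)
import Data.List.Relation.Unary.Unique.Propositional.Properties as Unique
open import Data.Nat using (zero; s≤s)
import Data.Nat as ℕ
import Data.Nat.Properties as ℕ
open import Data.Product using (_,_; proj₁; proj₂)
open import Data.Rational using (0ℚ; 1ℚ; ½; _+_; _*_; _-_; -_; 1/_; Positive; NonNegative; positive)
open import Data.Rational.Properties
open import Data.Rational.Solver using (module +-*-Solver)
open import Data.Vec using ([]; _∷_; replicate; zipWith)
import Data.Vec.Properties as Vec
open import Function using (_∘_; id)
open import Relation.Binary.PropositionalEquality
open import Relation.Nullary using (Dec; yes; no; contradiction)
open +-*-Solver using (solve; _:+_; _:*_; _:-_; :-_; _:=_; con)
open ≡-Reasoning

private
  variable
    A B : Set
    n : ℕ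

-- Finite sums of rationals over lists.

∑ : List A → (A → ℚ) → ℚ
∑ l f = sumℚ (map f l)

∑-cong : (l : List A) {f g : A → ℚ} → (∀ x → f x ≡ g x) → ∑ l f ≡ ∑ l g
∑-cong l f≗g = cong sumℚ (map-cong f≗g l)

∑-zero : (l : List A) → ∑ l (λ _ → 0ℚ) ≡ 0ℚ
∑-zero []      = refl
∑-zero (_ ∷ l) = trans (+-identityˡ _) (∑-zero l)

∑-+ : (l : List A) (f g : A → ℚ) → ∑ l (λ x → f x + g x) ≡ ∑ l f + ∑ l g
∑-+ []      f g = refl
∑-+ (x ∷ l) f g = trans (cong (f x + g x +_) (∑-+ l f g))
  (solve 4 (λ a b c d → (a :+ b) :+ (c :+ d) := (a :+ c) :+ (b :+ d)) refl
     (f x) (g x) (∑ l f) (∑ l g))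

∑-minus : (l : List A) (f g : A → ℚ) → ∑ l (λ x → f x - g x) ≡ ∑ l f - ∑ l g
∑-minus []      f g = refl
∑-minus (x ∷ l) f g = trans (cong (f x - g x +_) (∑-minus l f g))
  (solve 4 (λ a b c d → (a :- b) :+ (c :- d) := (a :+ c) :- (b :+ d)) refl
     (f x) (g x) (∑ l f) (∑ l g))

∑-* : (l : List A) (c : ℚ) (f : A → ℚ) → ∑ l (λ x → c * f x) ≡ c * ∑ l f
∑-* []      c f = sym (*-zeroʳ c)
∑-* (x ∷ l) c f = trans (cong (c * f x +_) (∑-* l c f)) (sym (*-distribˡ-+ c _ _))

∑-swap : (l : List A) (m : List B) (f : A → B → ℚ) →
         ∑ l (λ x → ∑ m (f x)) ≡ ∑ m (λ y → ∑ l (λ x → f x y))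
∑-swap []      m f = sym (∑-zero m)
∑-swap (x ∷ l) m f = trans (cong (∑ m (f x) +_) (∑-swap l m f))
                           (sym (∑-+ m (f x) (λ y → ∑ l (λ x → f x y))))

∑-map : (g : A → B) (l : List A) (f : B → ℚ) → ∑ (map g l) f ≡ ∑ l (f ∘ g)
∑-map g l f = cong sumℚ (sym (map-∘ l))

∑-++ : (l m : List A) (f : A → ℚ) → ∑ (l ++ m) f ≡ ∑ l f + ∑ m f
∑-++ []      m f = sym (+-identityˡ _)
∑-++ (x ∷ l) m f = trans (cong (f x +_) (∑-++ l m f)) (sym (+-assoc (f x) (∑ l f) (∑ m f)))

∑-verts : (f : Vertex (suc n) → ℚ) →
          ∑ (verts (suc n)) f ≡ ∑ (verts n) (f ∘ (false ∷_)) + ∑ (verts n) (f ∘ (true ∷_))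
∑-verts {n} f = trans (∑-++ (map (false ∷_) (verts n)) _ f)
  (cong₂ _+_ (∑-map (false ∷_) (verts n) f) (∑-map (true ∷_) (verts n) f))

-- Off the diagonal each unordered pair occurs in both orders, and the diagonal contributes zero.
-- Doubling the sum over `pairs l` avoids a division by two and gives access to unrestricted double
-- sums, which can be interchanged with sums over characters.
∑-pairs : (l : List A) (f : A → A → ℚ) → (∀ x → f x x ≡ 0ℚ) → (∀ x y → f x y ≡ f y x) →
          ∑ l (λ x → ∑ l (f x)) ≡
          ∑ (pairs l) (λ p → f (proj₁ p) (proj₂ p)) + ∑ (pairs l) (λ p → f (proj₁ p) (proj₂ p))
∑-pairs []      f f-diag f-sym = refl
∑-pairs (x ∷ l) f f-diag f-sym = begin
  (f x x + X) + ∑ l (λ y → f y x + ∑ l (f y))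
    ≡⟨ cong₂ (λ a b → (a + X) + b) (f-diag x) (∑-+ l _ _) ⟩
  (0ℚ + X) + (∑ l (λ y → f y x) + ∑ l (λ y → ∑ l (f y)))
    ≡⟨ cong₂ (λ a b → a + b) (+-identityˡ X)
         (cong₂ _+_ (∑-cong l (λ y → f-sym y x)) (∑-pairs l f f-diag f-sym)) ⟩
  X + (X + (P + P))
    ≡⟨ solve 2 (λ x p → x :+ (x :+ (p :+ p)) := (x :+ p) :+ (x :+ p)) refl X P ⟩
  (X + P) + (X + P)
    ≡⟨ cong (λ a → a + a) (sym split) ⟩
  ∑ (pairs (x ∷ l)) f′ + ∑ (pairs (x ∷ l)) f′ ∎
  where
  f′ = λ p → f (proj₁ p) (proj₂ p)
  X  = ∑ l (f x)
  P  = ∑ (pairs l) f′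
  split : ∑ (pairs (x ∷ l)) f′ ≡ X + P
  split = trans (∑-++ (map (x ,_) l) (pairs l) f′) (cong (_+ P) (∑-map (x ,_) l f′))

-- Boolean equality of vertices and sums against indicators.

==-≡ : (u : Vertex n) → (u == u) ≡ true
==-≡ u with Vec.≡-dec Bool._≟_ u u
... | yes _  = refl
... | no u≢u = contradiction refl u≢u

==-≢ : {u v : Vertex n} → u ≢ v → (u == v) ≡ false
==-≢ {u = u} {v} u≢v with Vec.≡-dec Bool._≟_ u v
... | yes u≡v = contradiction u≡v u≢v
... | no _    = refl

==-sym : (u v : Vertex n) → (u == v) ≡ (v == u)
==-sym u v with Vec.≡-dec Bool._≟_ u v
... | yes refl = sym (==-≡ u)
... | no u≢v   = sym (==-≢ (u≢v ∘ sym))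

==-∷ : ∀ b (u v : Vertex n) → ((b ∷ u) == (b ∷ v)) ≡ (u == v)
==-∷ b u v = by-cases (Vec.≡-dec Bool._≟_ u v)
  where
  by-cases : Dec (u ≡ v) → ((b ∷ u) == (b ∷ v)) ≡ (u == v)
  by-cases (yes refl) = trans (==-≡ (b ∷ u)) (sym (==-≡ u))
  by-cases (no u≢v)   = trans (==-≢ (u≢v ∘ Vec.∷-injectiveʳ)) (sym (==-≢ u≢v))

∑-select : (w : Vertex n) (f : Vertex n → ℚ) →
           ∑ (verts n) (λ u → if w == u then f u else 0ℚ) ≡ f w
∑-select []          f = +-identityʳ (f [])
∑-select {suc n} (false ∷ w) f = begin
  ∑ (verts (suc n)) _
    ≡⟨ ∑-verts (λ u → if (false ∷ w) == u then f u else 0ℚ) ⟩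
  ∑ (verts n) _ + ∑ (verts n) _
    ≡⟨ cong₂ _+_ (∑-cong (verts n) λ u → cong (λ b → if b then f (false ∷ u) else 0ℚ) (==-∷ false w u))
                 (∑-cong (verts n) λ u → cong (λ b → if b then f (true ∷ u) else 0ℚ)
                   (==-≢ {u = false ∷ w} {true ∷ u} λ ())) ⟩
  ∑ (verts n) (λ u → if w == u then f (false ∷ u) else 0ℚ) + ∑ (verts n) (λ _ → 0ℚ)
    ≡⟨ cong₂ _+_ (∑-select w (f ∘ (false ∷_))) (∑-zero (verts n)) ⟩
  f (false ∷ w) + 0ℚ ≡⟨ +-identityʳ _ ⟩
  f (false ∷ w) ∎
∑-select {suc n} (true ∷ w) f = begin
  ∑ (verts (suc n)) _
    ≡⟨ ∑-verts (λ u → if (true ∷ w) == u then f u else 0ℚ) ⟩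
  ∑ (verts n) _ + ∑ (verts n) _
    ≡⟨ cong₂ _+_ (∑-cong (verts n) λ u → cong (λ b → if b then f (false ∷ u) else 0ℚ)
                   (==-≢ {u = true ∷ w} {false ∷ u} λ ()))
                 (∑-cong (verts n) λ u → cong (λ b → if b then f (true ∷ u) else 0ℚ) (==-∷ true w u)) ⟩
  ∑ (verts n) (λ _ → 0ℚ) + ∑ (verts n) (λ u → if w == u then f (true ∷ u) else 0ℚ)
    ≡⟨ cong₂ _+_ (∑-zero (verts n)) (∑-select w (f ∘ (true ∷_))) ⟩
  0ℚ + f (true ∷ w) ≡⟨ +-identityˡ _ ⟩
  f (true ∷ w) ∎

∑-indicator : (a : Vertex n) (f : Vertex n → ℚ) →
              ∑ (verts n) (λ v → indicator a v * f v) ≡ f a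
∑-indicator {n} a f = trans (∑-cong (verts n) lemma) (∑-select a f)
  where
  if-* : ∀ b x → (if b then 1ℚ else 0ℚ) * x ≡ (if b then x else 0ℚ)
  if-* true  x = *-identityˡ x
  if-* false x = *-zeroˡ x
  lemma : ∀ v → indicator a v * f v ≡ (if a == v then f v else 0ℚ)
  lemma v = trans (if-* (v == a) (f v)) (cong (λ b → if b then f v else 0ℚ) (==-sym v a))

indicator-∷ : ∀ b (a v : Vertex n) → indicator (b ∷ a) (b ∷ v) ≡ indicator a v
indicator-∷ b a v = cong (λ b → if b then 1ℚ else 0ℚ) (==-∷ b v a)

any-==-false : (l : List (Vertex n)) {u : Vertex n} → All (u ≢_) l → any (_== u) l ≡ false
any-==-false []      []          = refl
any-==-false (w ∷ l) (u≢w ∷ u∉l) = cong₂ _∨_ (==-≢ (u≢w ∘ sym)) (any-==-false l u∉l)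

-- Since `l` has no repetitions, at most one disjunct of `any` holds at each `u`, so the conditional
-- splits additively along the list. This turns the adjacency test of the Laplacian into a sum over
-- neighbours.
∑-any : (l : List (Vertex n)) → Unique l → (f : Vertex n → ℚ) →
        ∑ (verts n) (λ u → if any (_== u) l then f u else 0ℚ) ≡ ∑ l f
∑-any {n} []      []             f = ∑-zero (verts n)
∑-any {n} (w ∷ l) (w∉l ∷ unique) f = begin
  ∑ (verts n) (λ u → if (w == u) ∨ any (_== u) l then f u else 0ℚ)
    ≡⟨ ∑-cong (verts n) split ⟩
  ∑ (verts n) (λ u → (if w == u then f u else 0ℚ) + (if any (_== u) l then f u else 0ℚ))
    ≡⟨ ∑-+ (verts n) _ _ ⟩
  _ ≡⟨ cong₂ _+_ (∑-select w f) (∑-any l unique f) ⟩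
  f w + ∑ l f ∎
  where
  split : ∀ u → (if (w == u) ∨ any (_== u) l then f u else 0ℚ) ≡
                (if w == u then f u else 0ℚ) + (if any (_== u) l then f u else 0ℚ)
  split u with Vec.≡-dec Bool._≟_ w u
  ... | yes refl rewrite any-==-false l w∉l = sym (+-identityʳ (f u))
  ... | no _     = sym (+-identityˡ _)

-- The enhanced hypercube as a Cayley graph of (ℤ/2)ⁿ.

infixl 6 _⊕_

_⊕_ : Vertex n → Vertex n → Vertex n
_⊕_ = zipWith _xor_

𝟘 : Vertex n
𝟘 = replicate _ false

⊕-identityʳ : (v : Vertex n) → v ⊕ 𝟘 ≡ v
⊕-identityʳ []          = refl
⊕-identityʳ (true ∷ v)  = cong (true ∷_) (⊕-identityʳ v)
⊕-identityʳ (false ∷ v) = cong (false ∷_) (⊕-identityʳ v)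

⊕-cancelʳ : (v g : Vertex n) → (v ⊕ g) ⊕ g ≡ v
⊕-cancelʳ []          []          = refl
⊕-cancelʳ (true  ∷ v) (true  ∷ g) = cong (true ∷_) (⊕-cancelʳ v g)
⊕-cancelʳ (true  ∷ v) (false ∷ g) = cong (true ∷_) (⊕-cancelʳ v g)
⊕-cancelʳ (false ∷ v) (true  ∷ g) = cong (false ∷_) (⊕-cancelʳ v g)
⊕-cancelʳ (false ∷ v) (false ∷ g) = cong (false ∷_) (⊕-cancelʳ v g)

⊕-cancelˡ : (v g : Vertex n) → v ⊕ (v ⊕ g) ≡ g
⊕-cancelˡ []          []          = refl
⊕-cancelˡ (true  ∷ v) (true  ∷ g) = cong (true ∷_) (⊕-cancelˡ v g)
⊕-cancelˡ (true  ∷ v) (false ∷ g) = cong (false ∷_) (⊕-cancelˡ v g)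
⊕-cancelˡ (false ∷ v) (true  ∷ g) = cong (true ∷_) (⊕-cancelˡ v g)
⊕-cancelˡ (false ∷ v) (false ∷ g) = cong (false ∷_) (⊕-cancelˡ v g)

⊕-injective : (v : Vertex n) {g h : Vertex n} → v ⊕ g ≡ v ⊕ h → g ≡ h
⊕-injective v {g} {h} eq = trans (sym (⊕-cancelˡ v g)) (trans (cong (v ⊕_) eq) (⊕-cancelˡ v h))

-- Translation permutes the vertices: each coordinate of `g` either preserves or exchanges the two
-- halves of the cube.
∑-translate : (g : Vertex n) (f : Vertex n → ℚ) → ∑ (verts n) (λ v → f (v ⊕ g)) ≡ ∑ (verts n) f
∑-translate []          f = refl
∑-translate {suc n} (false ∷ g) f = trans (∑-verts (λ v → f (v ⊕ (false ∷ g)))) (trans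
  (cong₂ _+_ (∑-translate g (f ∘ (false ∷_))) (∑-translate g (f ∘ (true ∷_))))
  (sym (∑-verts f)))
∑-translate {suc n} (true ∷ g) f = trans (∑-verts (λ v → f (v ⊕ (true ∷ g)))) (trans
  (cong₂ _+_ (∑-translate g (f ∘ (true ∷_))) (∑-translate g (f ∘ (false ∷_))))
  (trans (+-comm (∑ (verts n) (f ∘ (true ∷_))) _) (sym (∑-verts f))))

-- The coordinates after the first j, so that complementing x_k, …, x_n is translation by
-- suffix (k - 1).
suffix : ∀ {n} → ℕ → Vertex n
suffix {zero}  j       = []
suffix {suc n} zero    = true ∷ suffix zero
suffix {suc n} (suc j) = false ∷ suffix j

units : ∀ n → List (Vertex n)
units zero    = []
units (suc n) = (true ∷ 𝟘) ∷ map (false ∷_) (units n)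

generators : ∀ n → ℕ → List (Vertex n)
generators n j = suffix j ∷ units n

compFrom-suc : ∀ j (v : Vertex n) → compFrom (suc j) v ≡ v ⊕ suffix j
compFrom-suc j       []          = refl
compFrom-suc zero    (true ∷ v)  = cong (false ∷_) (compFrom-suc zero v)
compFrom-suc zero    (false ∷ v) = cong (true ∷_) (compFrom-suc zero v)
compFrom-suc (suc j) (true ∷ v)  = cong (true ∷_) (compFrom-suc j v)
compFrom-suc (suc j) (false ∷ v) = cong (false ∷_) (compFrom-suc j v)

flips-units : (v : Vertex n) → map (λ i → flipAt i v) (allFin n) ≡ map (v ⊕_) (units n)
flips-units []              = refl
flips-units {suc n} (b ∷ v) = cong₂ _∷_
  (cong₂ _∷_ (head b) (sym (⊕-identityʳ v)))
  (begin
    map (λ i → flipAt i (b ∷ v)) (tabulate Fin.suc)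
      ≡⟨ cong (map _) (sym (map-tabulate id Fin.suc)) ⟩
    map (λ i → flipAt i (b ∷ v)) (map Fin.suc (allFin n))
      ≡⟨ sym (map-∘ (allFin n)) ⟩
    map (λ i → b ∷ flipAt i v) (allFin n)
      ≡⟨ map-∘ (allFin n) ⟩
    map (b ∷_) (map (λ i → flipAt i v) (allFin n))
      ≡⟨ cong (map (b ∷_)) (flips-units v) ⟩
    map (b ∷_) (map (v ⊕_) (units n))
      ≡⟨ sym (map-∘ (units n)) ⟩
    map (λ g → b ∷ (v ⊕ g)) (units n)
      ≡⟨ map-cong (λ g → cong (_∷ (v ⊕ g)) (sym (xor-false b))) (units n) ⟩
    map (λ g → (b ∷ v) ⊕ (false ∷ g)) (units n)
      ≡⟨ map-∘ (units n) ⟩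
    map ((b ∷ v) ⊕_) (map (false ∷_) (units n)) ∎)
  where
  head : ∀ b → not b ≡ b xor true
  head true  = refl
  head false = refl
  xor-false : ∀ b → b xor false ≡ b
  xor-false true  = refl
  xor-false false = refl

units-unique : ∀ n → Unique (units n)
units-unique zero    = []
units-unique (suc n) = All.map⁺ (All.universal (λ _ ()) (units n))
                     ∷ Unique.map⁺ Vec.∷-injectiveʳ (units-unique n)

-- The bound leaves at least two ones in `suffix j`, while a unit has exactly one. Hence the
-- complementary edge never coincides with a flip of a single coordinate.
suffix∉units : ∀ {n} j → suc j < n → All (suffix j ≢_) (units n)
suffix∉units {suc zero}    zero    (s≤s ())
suffix∉units {suc (suc n)} zero    _ = (λ ()) ∷ All.map⁺ (All.universal (λ _ ()) (units (suc n)))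
suffix∉units {suc n}       (suc j) (s≤s j<n) =
  (λ ()) ∷ All.map⁺ (All.map (_∘ Vec.∷-injectiveʳ) (suffix∉units j j<n))

adj-generators : ∀ j (v u : Vertex n) →
                 adj (suc j) v u ≡ any (_== u) (map (v ⊕_) (generators n j))
adj-generators {n} j v u = trans (∨-comm _ (compFrom (suc j) v == u)) (cong₂ _∨_
  (cong (_== u) (compFrom-suc j v))
  (cong or (trans (map-∘ (allFin n)) (cong (map (_== u)) (flips-units v)))))

-- The neighbours of `v` are its translates by the generators. These are pairwise distinct, because
-- the generators are and translation by `v` is injective, so each neighbour is counted once.
laplacian-generators : ∀ {n} j → suc j < n → (x : Vertex n → ℚ) (v : Vertex n) →
                       laplacian n (suc j) x v ≡ ∑ (generators n j) (λ g → x v - x (v ⊕ g))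
laplacian-generators {n} j j<n x v = begin
  laplacian n (suc j) x v
    ≡⟨ ∑-cong (verts n) (λ u → cong (λ b → if b then x v - x u else 0ℚ) (adj-generators j v u)) ⟩
  _ ≡⟨ ∑-any (map (v ⊕_) (generators n j))
         (Unique.map⁺ (⊕-injective v) (suffix∉units j j<n ∷ units-unique n)) (λ u → x v - x u) ⟩
  ∑ (map (v ⊕_) (generators n j)) (λ u → x v - x u)
    ≡⟨ ∑-map (v ⊕_) (generators n j) (λ u → x v - x u) ⟩
  ∑ (generators n j) (λ g → x v - x (v ⊕ g)) ∎

-- Every generator is its own inverse, so substituting `v ⊕ g` for `v` moves the shift in the cross
-- term from `y` to `x`.
laplacian-symmetric : ∀ {n} j → suc j < n → (x y : Vertex n → ℚ) →
                      ∑ (verts n) (λ v → x v * laplacian n (suc j) y v) ≡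
                      ∑ (verts n) (λ v → laplacian n (suc j) x v * y v)
laplacian-symmetric {n} j j<n x y = begin
  ∑ V (λ v → x v * laplacian n (suc j) y v)
    ≡⟨ ∑-cong V (λ v → trans (cong (x v *_) (laplacian-generators j j<n y v))
                             (sym (∑-* G (x v) (λ g → y v - y (v ⊕ g))))) ⟩
  ∑ V (λ v → ∑ G (λ g → x v * (y v - y (v ⊕ g))))
    ≡⟨ ∑-swap V G (λ v g → x v * (y v - y (v ⊕ g))) ⟩
  ∑ G (λ g → ∑ V (λ v → x v * (y v - y (v ⊕ g))))
    ≡⟨ ∑-cong G move ⟩
  ∑ G (λ g → ∑ V (λ v → y v * (x v - x (v ⊕ g))))
    ≡⟨ sym (∑-swap V G (λ v g → y v * (x v - x (v ⊕ g)))) ⟩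
  ∑ V (λ v → ∑ G (λ g → y v * (x v - x (v ⊕ g))))
    ≡⟨ ∑-cong V (λ v → trans (∑-* G (y v) (λ g → x v - x (v ⊕ g)))
         (trans (cong (y v *_) (sym (laplacian-generators j j<n x v))) (*-comm (y v) _))) ⟩
  ∑ V (λ v → laplacian n (suc j) x v * y v) ∎
  where
  V = verts n
  G = generators n j
  expand : ∀ (x y : Vertex n → ℚ) g → ∑ V (λ v → x v * (y v - y (v ⊕ g))) ≡
           ∑ V (λ v → x v * y v) - ∑ V (λ v → x v * y (v ⊕ g))
  expand x y g = trans
    (∑-cong V (λ v → solve 3 (λ a b c → a :* (b :- c) := a :* b :- a :* c) refl
                       (x v) (y v) (y (v ⊕ g))))
    (∑-minus V (λ v → x v * y v) (λ v → x v * y (v ⊕ g)))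
  move : ∀ g → ∑ V (λ v → x v * (y v - y (v ⊕ g))) ≡ ∑ V (λ v → y v * (x v - x (v ⊕ g)))
  move g = begin
    ∑ V (λ v → x v * (y v - y (v ⊕ g)))
      ≡⟨ expand x y g ⟩
    ∑ V (λ v → x v * y v) - ∑ V (λ v → x v * y (v ⊕ g))
      ≡⟨ cong₂ _-_ (∑-cong V (λ v → *-comm (x v) (y v)))
           (trans (sym (∑-translate g (λ v → x v * y (v ⊕ g))))
             (∑-cong V (λ v → trans (cong (λ w → x (v ⊕ g) * y w) (⊕-cancelʳ v g))
                                    (*-comm (x (v ⊕ g)) (y v))))) ⟩
    ∑ V (λ v → y v * x v) - ∑ V (λ v → y v * x (v ⊕ g))
      ≡⟨ sym (expand y x g) ⟩
    ∑ V (λ v → y v * (x v - x (v ⊕ g))) ∎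

-- Characters of the group (ℤ/2)ⁿ

sgn : Bool → ℚ
sgn false = 1ℚ
sgn true  = - 1ℚ

sgn-xor : ∀ a b → sgn (a xor b) ≡ sgn a * sgn b
sgn-xor true  true  = refl
sgn-xor true  false = refl
sgn-xor false true  = refl
sgn-xor false false = refl

sgn-not : ∀ b → sgn (not b) ≡ - sgn b
sgn-not true  = refl
sgn-not false = refl

sgn² : ∀ b → sgn b * sgn b ≡ 1ℚ
sgn² true  = refl
sgn² false = refl

-- The bilinear form over the field with two elements; `dot s (suffix j)` is the parity of the
-- number of ones of `s` after the first `j` coordinates.
dot : Vertex n → Vertex n → Bool
dot []      []      = false
dot (a ∷ s) (b ∷ v) = (a ∧ b) xor dot s v

χ : Vertex n → Vertex n → ℚ
χ s v = sgn (dot s v)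

χ-⊕ : (s v w : Vertex n) → χ s (v ⊕ w) ≡ χ s v * χ s w
χ-⊕ []      []      []      = refl
χ-⊕ (a ∷ s) (b ∷ v) (c ∷ w) = begin
  sgn ((a ∧ (b xor c)) xor dot s (v ⊕ w))
    ≡⟨ sgn-xor (a ∧ (b xor c)) _ ⟩
  sgn (a ∧ (b xor c)) * χ s (v ⊕ w)
    ≡⟨ cong₂ _*_ (sgn-∧-xor a) (χ-⊕ s v w) ⟩
  (sgn (a ∧ b) * sgn (a ∧ c)) * (χ s v * χ s w)
    ≡⟨ solve 4 (λ p q x y → (p :* q) :* (x :* y) := (p :* x) :* (q :* y)) refl
         (sgn (a ∧ b)) (sgn (a ∧ c)) (χ s v) (χ s w) ⟩
  (sgn (a ∧ b) * χ s v) * (sgn (a ∧ c) * χ s w)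
    ≡⟨ sym (cong₂ _*_ (sgn-xor (a ∧ b) _) (sgn-xor (a ∧ c) _)) ⟩
  χ (a ∷ s) (b ∷ v) * χ (a ∷ s) (c ∷ w) ∎
  where
  sgn-∧-xor : ∀ a → sgn (a ∧ (b xor c)) ≡ sgn (a ∧ b) * sgn (a ∧ c)
  sgn-∧-xor true  = sgn-xor b c
  sgn-∧-xor false = refl

-- The reciprocal of the number of vertices, normalising the character sums.
ν : ℕ → ℚ
ν zero    = 1ℚ
ν (suc n) = ½ * ν n

-- Splitting on the first coordinate of `s`, the half with that bit set repeats the other half when
-- the first bits `b` and `c` agree and is its negative when they differ. The sum therefore doubles,
-- which the extra ½ in `ν` absorbs, or cancels.
orthogonality : (a v : Vertex n) → ν n * ∑ (verts n) (λ s → χ s a * χ s v) ≡ indicator a v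
orthogonality []      []      = refl
orthogonality {suc n} (b ∷ a) (c ∷ v) = trans
  (cong (ν (suc n) *_) (∑-verts (λ s → χ s (b ∷ a) * χ s (c ∷ v)))) (by-cases b c)
  where
  X = ∑ (verts n) (λ s → χ s a * χ s v)
  Y : Bool → Bool → ℚ
  Y b c = ∑ (verts n) (λ s → χ (true ∷ s) (b ∷ a) * χ (true ∷ s) (c ∷ v))
  double : (½ * ν n) * (X + X) ≡ ν n * X
  double = solve 2 (λ p x → (con ½ :* p) :* (x :+ x) := p :* x) refl (ν n) X
  cancel : (½ * ν n) * (X - X) ≡ 0ℚ
  cancel = solve 2 (λ p x → (con ½ :* p) :* (x :- x) := con 0ℚ) refl (ν n) X
  negate : {f : Vertex n → ℚ} → (∀ s → f s ≡ - (χ s a * χ s v)) → ∑ (verts n) f ≡ - X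
  negate {f} f≗ = begin
    ∑ (verts n) f
      ≡⟨ ∑-cong (verts n) (λ s → trans (f≗ s) (neg-one (χ s a * χ s v))) ⟩
    ∑ (verts n) (λ s → - 1ℚ * (χ s a * χ s v))
      ≡⟨ ∑-* (verts n) (- 1ℚ) (λ s → χ s a * χ s v) ⟩
    - 1ℚ * X
      ≡⟨ sym (neg-one X) ⟩
    - X ∎
    where
    neg-one : ∀ x → - x ≡ - 1ℚ * x
    neg-one = solve 1 (λ x → :- x := con (- 1ℚ) :* x) refl
  by-cases : ∀ b c → (½ * ν n) * (X + Y b c) ≡ indicator (b ∷ a) (c ∷ v)
  by-cases false false = trans double (trans (orthogonality a v) (sym (indicator-∷ false a v)))
  by-cases true  true  = begin
    (½ * ν n) * (X + Y true true)
      ≡⟨ cong (λ y → (½ * ν n) * (X + y)) (∑-cong (verts n) (λ s →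
           trans (cong₂ _*_ (sgn-not (dot s a)) (sgn-not (dot s v)))
             (solve 2 (λ p q → (:- p) :* (:- q) := p :* q) refl (χ s a) (χ s v)))) ⟩
    (½ * ν n) * (X + X) ≡⟨ double ⟩
    ν n * X             ≡⟨ orthogonality a v ⟩
    indicator a v       ≡⟨ sym (indicator-∷ true a v) ⟩
    indicator (true ∷ a) (true ∷ v) ∎
  by-cases true false = begin
    (½ * ν n) * (X + Y true false)
      ≡⟨ cong (λ y → (½ * ν n) * (X + y)) (negate (λ s →
           trans (cong (_* χ s v) (sgn-not (dot s a))) (sym (neg-distribˡ-* (χ s a) (χ s v))))) ⟩
    (½ * ν n) * (X - X) ≡⟨ cancel ⟩
    0ℚ ≡⟨ cong (λ b → if b then 1ℚ else 0ℚ) (sym (==-≢ {u = false ∷ v} {true ∷ a} λ ())) ⟩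
    indicator (true ∷ a) (false ∷ v) ∎
  by-cases false true = begin
    (½ * ν n) * (X + Y false true)
      ≡⟨ cong (λ y → (½ * ν n) * (X + y)) (negate (λ s →
           trans (cong (χ s a *_) (sgn-not (dot s v))) (sym (neg-distribʳ-* (χ s a) (χ s v))))) ⟩
    (½ * ν n) * (X - X) ≡⟨ cancel ⟩
    0ℚ ≡⟨ cong (λ b → if b then 1ℚ else 0ℚ) (sym (==-≢ {u = true ∷ v} {false ∷ a} λ ())) ⟩
    indicator (false ∷ a) (true ∷ v) ∎

-- Eigenvalues of the Laplacian

ι : ℕ → ℚ
ι zero    = 0ℚ
ι (suc m) = 1ℚ + ι m

ι-+ : ∀ m n → ι (m ℕ.+ n) ≡ ι m + ι n
ι-+ zero    n = sym (+-identityˡ (ι n))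
ι-+ (suc m) n = trans (cong (1ℚ +_) (ι-+ m n)) (sym (+-assoc 1ℚ (ι m) (ι n)))

ι-nonNeg : ∀ m → NonNegative (ι m)
ι-nonNeg zero    = _
ι-nonNeg (suc m) = pos⇒nonNeg (ι (suc m)) {{pos+nonNeg⇒pos 1ℚ (ι m) {{ι-nonNeg m}}}}

ι-pos : ∀ m → Positive (ι (suc m))
ι-pos m = pos+nonNeg⇒pos 1ℚ (ι m) {{ι-nonNeg m}}

-- The value at 0 is chosen so that the trivial character contributes nothing.
recip : ℕ → ℚ
recip zero    = 0ℚ
recip (suc m) = 1/_ (ι (suc m)) {{pos⇒nonZero (ι (suc m)) {{ι-pos m}}}}

ι-recip : ∀ m → ι (suc m) * recip (suc m) ≡ 1ℚ
ι-recip m = *-inverseʳ (ι (suc m)) {{pos⇒nonZero (ι (suc m)) {{ι-pos m}}}}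

par : Bool → ℕ
par false = 0
par true  = 1

weight : Vertex n → ℕ
weight []      = 0
weight (b ∷ s) = par b ℕ.+ weight s

-- Half of the Laplacian eigenvalue of χ s when c is the extra generator.
halfEig : Vertex n → Vertex n → ℕ
halfEig c s = weight s ℕ.+ par (dot s c)

recipSum : (n : ℕ) → (Vertex n → ℕ) → ℚ
recipSum n f = ∑ (verts n) (recip ∘ f)

recipSum-cong : ∀ n {f g : Vertex n → ℕ} → (∀ s → f s ≡ g s) → recipSum n f ≡ recipSum n g
recipSum-cong n f≗g = ∑-cong (verts n) (cong recip ∘ f≗g)

recipSum-suc : ∀ n (f : Vertex (suc n) → ℕ) →
               recipSum (suc n) f ≡ recipSum n (f ∘ (false ∷_)) + recipSum n (f ∘ (true ∷_))
recipSum-suc n f = ∑-verts {n} (recip ∘ f)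

dot-𝟘 : (s : Vertex n) → dot s 𝟘 ≡ false
dot-𝟘 []          = refl
dot-𝟘 (true ∷ s)  = dot-𝟘 s
dot-𝟘 (false ∷ s) = dot-𝟘 s

weight-zero⇒dot : (s : Vertex n) → weight s ≡ 0 → ∀ v → dot s v ≡ false
weight-zero⇒dot []          _  []      = refl
weight-zero⇒dot (false ∷ s) eq (_ ∷ v) = weight-zero⇒dot s eq v

1-sgn : ∀ b → 1ℚ - sgn b ≡ ι (par b) + ι (par b)
1-sgn true  = refl
1-sgn false = refl

∑-units : (s : Vertex n) → ∑ (units n) (λ g → 1ℚ - χ s g) ≡ ι (weight s) + ι (weight s)
∑-units []              = refl
∑-units {suc n} (b ∷ s) = begin
  (1ℚ - χ (b ∷ s) (true ∷ 𝟘)) + ∑ (map (false ∷_) (units n)) (λ g → 1ℚ - χ (b ∷ s) g)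
    ≡⟨ cong₂ _+_ (trans (cong (λ p → 1ℚ - sgn p) (head b)) (1-sgn b))
         (trans (∑-map (false ∷_) (units n) (λ g → 1ℚ - χ (b ∷ s) g))
                (trans (∑-cong (units n) (λ g → cong (λ p → 1ℚ - sgn p) (tail b g))) (∑-units s))) ⟩
  (ι (par b) + ι (par b)) + (ι (weight s) + ι (weight s))
    ≡⟨ solve 2 (λ p w → (p :+ p) :+ (w :+ w) := (p :+ w) :+ (p :+ w)) refl
         (ι (par b)) (ι (weight s)) ⟩
  (ι (par b) + ι (weight s)) + (ι (par b) + ι (weight s))
    ≡⟨ sym (cong (λ x → x + x) (ι-+ (par b) (weight s))) ⟩
  ι (weight (b ∷ s)) + ι (weight (b ∷ s)) ∎
  where
  head : ∀ b → dot (b ∷ s) (true ∷ 𝟘) ≡ b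
  head true  = cong not (dot-𝟘 s)
  head false = dot-𝟘 s
  tail : ∀ b g → dot (b ∷ s) (false ∷ g) ≡ dot s g
  tail true  g = refl
  tail false g = refl

-- This sum is the Laplacian eigenvalue of `χ s`: a generator contributes 2 where the character is
-- -1 and 0 where it is 1. The units account for `weight s`, and the extra generator for the parity
-- term.
∑-generators : ∀ j (s : Vertex n) → let ℓ = ι (halfEig (suffix j) s) in
               ∑ (generators n j) (λ g → 1ℚ - χ s g) ≡ ℓ + ℓ
∑-generators j s = trans (cong₂ _+_ (1-sgn (dot s (suffix j))) (∑-units s))
  (trans (solve 2 (λ p w → (p :+ p) :+ (w :+ w) := (w :+ p) :+ (w :+ p)) refl
            (ι (par (dot s (suffix j)))) (ι (weight s)))
         (sym (cong (λ x → x + x) (ι-+ (weight s) (par (dot s (suffix j)))))))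

-- Potentials from inverted eigenvalues, and uniqueness of the resistance.

module _ {n : ℕ} (j : ℕ) (j<n : suc j < n) where

  private
    V = verts n
    G = generators n j

  ℓ : Vertex n → ℕ
  ℓ = halfEig (suffix j)

  -- The eigenvalue is twice `ℓ s`, so ½ times `recip` inverts it; on the trivial character the
  -- value is zero, as for a pseudoinverse.
  coeff : Vertex n → ℚ
  coeff s = (½ * ν n) * recip (ℓ s)

  -- The pseudoinverse of the Laplacian applied to `indicator a - indicator b`, expanded in
  -- characters.
  potential : Vertex n → Vertex n → Vertex n → ℚ
  potential a b v = ∑ V (λ s → (coeff s * (χ s a - χ s b)) * χ s v)

  -- Each character is an eigenvector, because multiplicativity gives `χ s (v ⊕ g)` as
  -- `χ s v * χ s g`; the eigenvalue then factors out of the sum over generators.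
  laplacian-∑χ : (c : Vertex n → ℚ) (v : Vertex n) →
                 laplacian n (suc j) (λ v → ∑ V (λ s → c s * χ s v)) v ≡
                 ∑ V (λ s → (c s * χ s v) * (ι (ℓ s) + ι (ℓ s)))
  laplacian-∑χ c v = begin
    laplacian n (suc j) (λ v → ∑ V (λ s → c s * χ s v)) v
      ≡⟨ laplacian-generators j j<n (λ v → ∑ V (λ s → c s * χ s v)) v ⟩
    ∑ G (λ g → ∑ V (λ s → c s * χ s v) - ∑ V (λ s → c s * χ s (v ⊕ g)))
      ≡⟨ ∑-cong G (λ g → trans (sym (∑-minus V (λ s → c s * χ s v) (λ s → c s * χ s (v ⊕ g))))
           (∑-cong V (λ s → trans (cong (λ x → c s * χ s v - c s * x) (χ-⊕ s v g))
             (solve 3 (λ p q r → p :* q :- p :* (q :* r) := (p :* q) :* (con 1ℚ :- r)) refl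
                (c s) (χ s v) (χ s g))))) ⟩
    ∑ G (λ g → ∑ V (λ s → (c s * χ s v) * (1ℚ - χ s g)))
      ≡⟨ ∑-swap G V (λ g s → (c s * χ s v) * (1ℚ - χ s g)) ⟩
    ∑ V (λ s → ∑ G (λ g → (c s * χ s v) * (1ℚ - χ s g)))
      ≡⟨ ∑-cong V (λ s → trans (∑-* G (c s * χ s v) (λ g → 1ℚ - χ s g))
                               (cong (c s * χ s v *_) (∑-generators j s))) ⟩
    ∑ V (λ s → (c s * χ s v) * (ι (ℓ s) + ι (ℓ s))) ∎

  -- For positive weight `ℓ s` is positive and the two factors are inverse to each other. For weight
  -- zero the character is constantly 1, so the difference vanishes: the injected current has total
  -- zero and hence no component along the trivial character.
  recip-cancel : ∀ a b s → (ι (ℓ s) * recip (ℓ s)) * (χ s a - χ s b) ≡ χ s a - χ s b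
  recip-cancel a b s with weight s in eq
  ... | suc w = trans (cong (_* (χ s a - χ s b)) (ι-recip (w ℕ.+ par (dot s (suffix j)))))
                      (*-identityˡ _)
  ... | zero rewrite weight-zero⇒dot s eq a | weight-zero⇒dot s eq b =
    *-zeroʳ (ι (par (dot s (suffix j))) * recip (par (dot s (suffix j))))

  -- The eigenvalues cancel against the coefficients, and orthogonality collapses the remaining
  -- character sums to the two indicators.
  laplacian-potential : ∀ a b v →
    laplacian n (suc j) (potential a b) v ≡ indicator a v - indicator b v
  laplacian-potential a b v = begin
    laplacian n (suc j) (potential a b) v
      ≡⟨ laplacian-∑χ (λ s → coeff s * (χ s a - χ s b)) v ⟩
    ∑ V (λ s → ((coeff s * (χ s a - χ s b)) * χ s v) * (ι (ℓ s) + ι (ℓ s)))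
      ≡⟨ ∑-cong V (λ s → trans
           (solve 5 (λ p q d x i → (((con ½ :* p) :* q) :* d :* x) :* (i :+ i)
                                 := (p :* ((i :* q) :* d)) :* x)
              refl (ν n) (recip (ℓ s)) (χ s a - χ s b) (χ s v) (ι (ℓ s)))
           (trans (cong (λ d → (ν n * d) * χ s v) (recip-cancel a b s))
              (solve 4 (λ p x y z → (p :* (x :- y)) :* z := p :* (x :* z) :- p :* (y :* z))
                 refl (ν n) (χ s a) (χ s b) (χ s v)))) ⟩
    ∑ V (λ s → ν n * (χ s a * χ s v) - ν n * (χ s b * χ s v))
      ≡⟨ ∑-minus V (λ s → ν n * (χ s a * χ s v)) (λ s → ν n * (χ s b * χ s v)) ⟩
    ∑ V (λ s → ν n * (χ s a * χ s v)) - ∑ V (λ s → ν n * (χ s b * χ s v))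
      ≡⟨ cong₂ _-_ (trans (∑-* V (ν n) (λ s → χ s a * χ s v)) (orthogonality a v))
                   (trans (∑-* V (ν n) (λ s → χ s b * χ s v)) (orthogonality b v)) ⟩
    indicator a v - indicator b v ∎

  resistance : Vertex n → Vertex n → ℚ
  resistance a b = potential a b a - potential a b b

  resistance-isResistance : IsResistanceFn n (suc j) resistance
  resistance-isResistance a b = potential a b , laplacian-potential a b , refl

  -- Pairing with the Laplacian is symmetric, so ⟨x , L y⟩ = ⟨L x , y⟩ compares the two
  -- potential differences.
  resistance-unique : ∀ {r} → IsResistanceFn n (suc j) r → ∀ a b → r a b ≡ resistance a b
  resistance-unique {r} isR a b with isR a b
  ... | x , Lx , r≡ = begin
    r a b
      ≡⟨ r≡ ⟩
    x a - x b
      ≡⟨ sym (evaluate x) ⟩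
    ∑ V (λ v → x v * (indicator a v - indicator b v))
      ≡⟨ ∑-cong V (λ v → cong (x v *_) (sym (laplacian-potential a b v))) ⟩
    ∑ V (λ v → x v * laplacian n (suc j) y v)
      ≡⟨ laplacian-symmetric j j<n x y ⟩
    ∑ V (λ v → laplacian n (suc j) x v * y v)
      ≡⟨ ∑-cong V (λ v → trans (cong (_* y v) (Lx v)) (*-comm _ (y v))) ⟩
    ∑ V (λ v → y v * (indicator a v - indicator b v))
      ≡⟨ evaluate y ⟩
    y a - y b ∎
    where
    y = potential a b
    evaluate : ∀ z → ∑ V (λ v → z v * (indicator a v - indicator b v)) ≡ z a - z b
    evaluate z = begin
      ∑ V (λ v → z v * (indicator a v - indicator b v))
        ≡⟨ ∑-cong V (λ v → solve 3 (λ p q r → p :* (q :- r) := q :* p :- r :* p) refl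
                             (z v) (indicator a v) (indicator b v)) ⟩
      ∑ V (λ v → indicator a v * z v - indicator b v * z v)
        ≡⟨ ∑-minus V (λ v → indicator a v * z v) (λ v → indicator b v * z v) ⟩
      ∑ V (λ v → indicator a v * z v) - ∑ V (λ v → indicator b v * z v)
        ≡⟨ cong₂ _-_ (∑-indicator a z) (∑-indicator b z) ⟩
      z a - z b ∎

-- The Kirchhoff index as a sum of reciprocal eigenvalues.

-- At the first coordinate where `s` has a one, the two halves of the cube carry opposite signs and
-- cancel.
χ-sum : (s : Vertex n) → weight s ≢ 0 → ∑ (verts n) (χ s) ≡ 0ℚ
χ-sum []                  s≢0 = contradiction refl s≢0
χ-sum {suc n} (false ∷ s) s≢0 = trans (∑-verts (χ (false ∷ s))) (cong₂ _+_ (χ-sum s s≢0) (χ-sum s s≢0))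
χ-sum {suc n} (true ∷ s)  _   = begin
  ∑ (verts (suc n)) (χ (true ∷ s))
    ≡⟨ ∑-verts (χ (true ∷ s)) ⟩
  X + Y
    ≡⟨ sym (∑-+ (verts n) (χ s) (λ v → sgn (not (dot s v)))) ⟩
  ∑ (verts n) (λ v → χ s v + sgn (not (dot s v)))
    ≡⟨ ∑-cong (verts n) (λ v → trans (cong (χ s v +_) (sgn-not (dot s v))) (+-inverseʳ (χ s v))) ⟩
  ∑ (verts n) (λ _ → 0ℚ)
    ≡⟨ ∑-zero (verts n) ⟩
  0ℚ ∎
  where
  X = ∑ (verts n) (χ s)
  Y = ∑ (verts n) (λ v → sgn (not (dot s v)))

-- Signs square to 1, so the square expands to 2 minus twice a product of character values, and the
-- product sums to zero over `b`. The total is thus the same for every nontrivial `s`; it stays an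
-- unevaluated sum because only its positivity matters later.
χ-distance : (s : Vertex n) → weight s ≢ 0 →
             ∑ (verts n) (λ a → ∑ (verts n) (λ b → (χ s a - χ s b) * (χ s a - χ s b))) ≡
             ∑ (verts n) (λ _ → ∑ (verts n) (λ _ → 1ℚ + 1ℚ))
χ-distance {n} s s≢0 = ∑-cong V λ a → begin
  ∑ V (λ b → (χ s a - χ s b) * (χ s a - χ s b))
    ≡⟨ ∑-cong V (λ b → trans
         (solve 2 (λ x y → (x :- y) :* (x :- y) := (x :* x :+ y :* y) :- (x :+ x) :* y) refl
            (χ s a) (χ s b))
         (cong (_- (χ s a + χ s a) * χ s b) (cong₂ _+_ (sgn² (dot s a)) (sgn² (dot s b))))) ⟩
  ∑ V (λ b → (1ℚ + 1ℚ) - (χ s a + χ s a) * χ s b)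
    ≡⟨ ∑-minus V (λ _ → 1ℚ + 1ℚ) (λ b → (χ s a + χ s a) * χ s b) ⟩
  T - ∑ V (λ b → (χ s a + χ s a) * χ s b)
    ≡⟨ cong (λ x → T - x) (trans (∑-* V (χ s a + χ s a) (χ s))
         (trans (cong ((χ s a + χ s a) *_) (χ-sum s s≢0)) (*-zeroʳ (χ s a + χ s a)))) ⟩
  T - 0ℚ
    ≡⟨ +-identityʳ T ⟩
  T ∎
  where
  V = verts n
  T = ∑ V (λ _ → 1ℚ + 1ℚ)

-- The value is 2ⁿ; it is the same for every `j`.
scale : ℕ → ℚ
scale n = (½ * ν n) * ∑ (verts n) (λ _ → ∑ (verts n) (λ _ → 1ℚ + 1ℚ))

module _ {n : ℕ} (j : ℕ) (j<n : suc j < n) where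

  private
    V = verts n
    R = resistance j j<n
    c = coeff j j<n
    ℓ′ = ℓ j j<n

  -- Evaluating the potential at both ends produces the factor `χ s a - χ s b` a second time; the
  -- square makes symmetry in `a` and `b` evident.
  resistance-square : ∀ a b → R a b ≡ ∑ V (λ s → c s * ((χ s a - χ s b) * (χ s a - χ s b)))
  resistance-square a b = trans
    (sym (∑-minus V (λ s → (c s * (χ s a - χ s b)) * χ s a) (λ s → (c s * (χ s a - χ s b)) * χ s b)))
    (∑-cong V (λ s → solve 3 (λ p x y → (p :* (x :- y)) :* x :- (p :* (x :- y)) :* y
                                      := p :* ((x :- y) :* (x :- y))) refl
                       (c s) (χ s a) (χ s b)))

  resistance-diag : ∀ a → R a a ≡ 0ℚ
  resistance-diag a = +-inverseʳ (potential j j<n a a a)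

  resistance-sym : ∀ a b → R a b ≡ R b a
  resistance-sym a b = trans (resistance-square a b) (trans
    (∑-cong V (λ s → solve 3 (λ p x y → p :* ((x :- y) :* (x :- y)) := p :* ((y :- x) :* (y :- x)))
                       refl (c s) (χ s a) (χ s b)))
    (sym (resistance-square b a)))

  coeff-distance : ∀ s →
    c s * ∑ V (λ a → ∑ V (λ b → (χ s a - χ s b) * (χ s a - χ s b))) ≡ scale n * recip (ℓ′ s)
  coeff-distance s = by-cases (weight s ℕ.≟ 0)
    where
    by-cases : Dec (weight s ≡ 0) → _
    by-cases (no s≢0) = trans (cong (c s *_) (χ-distance s s≢0))
      (solve 3 (λ p q d → (p :* q) :* d := (p :* d) :* q) refl (½ * ν n) (recip (ℓ′ s)) _)
    by-cases (yes s≡0) = trans (trans (cong (_* D) c≡0) (*-zeroˡ D))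
      (sym (trans (cong (scale n *_) recip≡0) (*-zeroʳ (scale n))))
      where
      D = ∑ V (λ a → ∑ V (λ b → (χ s a - χ s b) * (χ s a - χ s b)))
      recip≡0 : recip (ℓ′ s) ≡ 0ℚ
      recip≡0 = cong recip (cong₂ ℕ._+_ s≡0 (cong par (weight-zero⇒dot s s≡0 (suffix j))))
      c≡0 : c s ≡ 0ℚ
      c≡0 = trans (cong ((½ * ν n) *_) recip≡0) (*-zeroʳ (½ * ν n))

  -- Uniqueness replaces `r` by the explicit resistances. Summing these over ordered pairs and
  -- interchanging sums leaves, for each character, a constant multiple of its reciprocal
  -- half-eigenvalue.
  kirchhoff-formula : ∀ {r} → IsResistanceFn n (suc j) r →
                      kirchhoff n r + kirchhoff n r ≡ scale n * recipSum n ℓ′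
  kirchhoff-formula {r} isR = begin
    kirchhoff n r + kirchhoff n r
      ≡⟨ cong (λ x → x + x) (∑-cong (pairs V)
           (λ p → resistance-unique j j<n isR (proj₁ p) (proj₂ p))) ⟩
    kirchhoff n R + kirchhoff n R
      ≡⟨ sym (∑-pairs V R resistance-diag resistance-sym) ⟩
    ∑ V (λ a → ∑ V (R a))
      ≡⟨ ∑-cong V (λ a → trans (∑-cong V (resistance-square a))
                               (∑-swap V V (λ b s → c s * sq s a b))) ⟩
    ∑ V (λ a → ∑ V (λ s → ∑ V (λ b → c s * sq s a b)))
      ≡⟨ ∑-swap V V (λ a s → ∑ V (λ b → c s * sq s a b)) ⟩
    ∑ V (λ s → ∑ V (λ a → ∑ V (λ b → c s * sq s a b)))
      ≡⟨ ∑-cong V (λ s → trans (∑-cong V (λ a → ∑-* V (c s) (sq s a)))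
                        (trans (∑-* V (c s) (λ a → ∑ V (sq s a))) (coeff-distance s))) ⟩
    ∑ V (λ s → scale n * recip (ℓ′ s))
      ≡⟨ ∑-* V (scale n) (recip ∘ ℓ′) ⟩
    scale n * recipSum n ℓ′ ∎
    where
    sq : Vertex n → Vertex n → Vertex n → ℚ
    sq s a b = (χ s a - χ s b) * (χ s a - χ s b)

-- Positivity of the scaling factor.

∑-verts-pos : ∀ n (f : Vertex n → ℚ) → (∀ v → Positive (f v)) → Positive (∑ (verts n) f)
∑-verts-pos zero    f f-pos = subst Positive (sym (+-identityʳ (f []))) (f-pos [])
∑-verts-pos (suc n) f f-pos = subst Positive (sym (∑-verts f))
  (pos+pos⇒pos (∑ (verts n) (f ∘ (false ∷_)))
               {{∑-verts-pos n (f ∘ (false ∷_)) (f-pos ∘ (false ∷_))}}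
               (∑ (verts n) (f ∘ (true ∷_)))
               {{∑-verts-pos n (f ∘ (true ∷_)) (f-pos ∘ (true ∷_))}})

ν-pos : ∀ n → Positive (ν n)
ν-pos zero    = _
ν-pos (suc n) = pos*pos⇒pos ½ (ν n) {{ν-pos n}}

scale-pos : ∀ n → Positive (scale n)
scale-pos n = pos*pos⇒pos (½ * ν n) {{pos*pos⇒pos ½ (ν n) {{ν-pos n}}}} _
  {{∑-verts-pos n _ (λ _ → ∑-verts-pos n _ (λ _ → _))}}

-- Iterated differences of 1/(m+1)

Δrecip : ℕ → ℕ → ℚ
Δrecip zero    m = recip (suc m)
Δrecip (suc p) m = Δrecip p m - Δrecip p (suc m)

ι-suc-+-suc : ∀ p m → ι (suc (suc (p ℕ.+ m))) ≡ ι (suc p) + ι (suc m)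
ι-suc-+-suc p m = trans (cong (ι ∘ suc) (sym (ℕ.+-suc p m))) (ι-+ (suc p) (suc m))

-- Both recurrences express Δrecip p m = p! m! / (p + m + 1)!.
mutual
  Δrecip-shift : ∀ p m → ι (suc (suc (p ℕ.+ m))) * Δrecip p (suc m) ≡ ι (suc m) * Δrecip p m
  Δrecip-shift zero    m = trans (ι-recip (suc m)) (sym (ι-recip m))
  Δrecip-shift (suc p) m = begin
    ι (suc (suc (suc p ℕ.+ m))) * Δrecip (suc p) (suc m)
      ≡⟨ cong (λ k → ι (suc (suc k)) * Δrecip (suc p) (suc m)) (sym (ℕ.+-suc p m)) ⟩
    ι (suc (suc (p ℕ.+ suc m))) * Δrecip (suc p) (suc m)
      ≡⟨ Δrecip-suc p (suc m) ⟩
    ι (suc p) * y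
      ≡⟨ solve 3 (λ i k y → i :* y := (i :+ k) :* y :- k :* y) refl (ι (suc p)) (ι (suc m)) y ⟩
    (ι (suc p) + ι (suc m)) * y - ι (suc m) * y
      ≡⟨ cong (λ z → z * y - ι (suc m) * y) (sym (ι-suc-+-suc p m)) ⟩
    ι (suc (suc (p ℕ.+ m))) * y - ι (suc m) * y
      ≡⟨ cong (_- ι (suc m) * y) (Δrecip-shift p m) ⟩
    ι (suc m) * x - ι (suc m) * y
      ≡⟨ solve 3 (λ k x y → k :* x :- k :* y := k :* (x :- y)) refl (ι (suc m)) x y ⟩
    ι (suc m) * Δrecip (suc p) m ∎
    where
    x = Δrecip p m
    y = Δrecip p (suc m)

  Δrecip-suc : ∀ p m → ι (suc (suc (p ℕ.+ m))) * Δrecip (suc p) m ≡ ι (suc p) * Δrecip p m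
  Δrecip-suc p m = begin
    N * (x - y)
      ≡⟨ solve 3 (λ k x y → k :* (x :- y) := k :* x :- k :* y) refl N x y ⟩
    N * x - N * y
      ≡⟨ cong₂ (λ k z → k * x - z) (ι-suc-+-suc p m) (Δrecip-shift p m) ⟩
    (ι (suc p) + ι (suc m)) * x - ι (suc m) * x
      ≡⟨ solve 3 (λ i k x → (i :+ k) :* x :- k :* x := i :* x) refl (ι (suc p)) (ι (suc m)) x ⟩
    ι (suc p) * x ∎
    where
    N = ι (suc (suc (p ℕ.+ m)))
    x = Δrecip p m
    y = Δrecip p (suc m)

-- By `Δrecip-suc`, a positive multiple of the next difference is a positive multiple of the current
-- one, so positivity passes up the order `p`.
Δrecip-pos : ∀ p m → Positive (Δrecip p m)
Δrecip-pos zero    m = 1/pos⇒pos (ι (suc m)) {{ι-pos m}}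
Δrecip-pos (suc p) m = positive (*-cancelˡ-<-nonNeg N {{ι-nonNeg (suc (suc (p ℕ.+ m)))}}
  (subst₂ _<ℚ_ (sym (*-zeroʳ N)) (sym (Δrecip-suc p m))
    (positive⁻¹ _ {{pos*pos⇒pos (ι (suc p)) {{ι-pos p}} (Δrecip p m) {{Δrecip-pos p m}}}})))
  where
  N = ι (suc (suc (p ℕ.+ m)))

-- Comparison of the reciprocal sums for consecutive suffixes.

-- `halfEig` with the parity reversed, as happens when a further bit of `s` inside the suffix is
-- set.
complementary : Vertex n → Vertex n → ℕ
complementary c s = weight s ℕ.+ par (not (dot s c))

-- For `suffix 0` the parity is that of `weight s`, so the left side is the sum of the differences
-- 1/(m+1) - 1/(m+2) at m = w + |s| with sign (-1)^|s|. Setting the first bit raises `w` by one and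
-- exchanges the two sums, which is exactly the recurrence defining `Δrecip`.
∑-alternating : ∀ n w →
  recipSum n (λ s → suc (w ℕ.+ halfEig (suffix 0) s)) -
  recipSum n (λ s → suc (w ℕ.+ complementary (suffix 0) s)) ≡
  Δrecip (suc n) w
∑-alternating zero w = cong₂ _-_
  (trans (+-identityʳ (recip (suc (w ℕ.+ 0)))) (cong (recip ∘ suc) (ℕ.+-identityʳ w)))
  (trans (+-identityʳ (recip (suc (w ℕ.+ 1)))) (cong (recip ∘ suc) (ℕ.+-comm w 1)))
∑-alternating (suc n) w = begin
  recipSum (suc n) (λ s → suc (w ℕ.+ halfEig (suffix 0) s)) -
  recipSum (suc n) (λ s → suc (w ℕ.+ complementary (suffix 0) s))
    ≡⟨ cong₂ _-_
         (trans (recipSum-suc n (λ s → suc (w ℕ.+ halfEig (suffix 0) s)))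
           (cong (E w +_) (recipSum-cong n (λ s → cong suc (ℕ.+-suc w _)))))
         (trans (recipSum-suc n (λ s → suc (w ℕ.+ complementary (suffix 0) s)))
           (cong (O w +_) (recipSum-cong n (λ s → cong suc (trans (ℕ.+-suc w _)
             (cong (λ b → suc (w ℕ.+ (weight s ℕ.+ par b))) (not-involutive (dot s (suffix 0))))))))) ⟩
  (E w + O (suc w)) - (O w + E (suc w))
    ≡⟨ solve 4 (λ a b c d → (a :+ b) :- (c :+ d) := (a :- c) :- (d :- b)) refl
         (E w) (O (suc w)) (O w) (E (suc w)) ⟩
  (E w - O w) - (E (suc w) - O (suc w))
    ≡⟨ cong₂ _-_ (∑-alternating n w) (∑-alternating n (suc w)) ⟩
  Δrecip (suc (suc n)) w ∎
  where
  E O : ℕ → ℚ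
  E w = recipSum n (λ s → suc (w ℕ.+ halfEig (suffix 0) s))
  O w = recipSum n (λ s → suc (w ℕ.+ complementary (suffix 0) s))

pos-difference⇒< : ∀ p q → Positive (q - p) → p <ℚ q
pos-difference⇒< p q pos = subst₂ _<ℚ_ (+-identityʳ p)
  (solve 2 (λ p q → p :+ (q :- p) := q) refl p q) (+-monoʳ-< p (positive⁻¹ (q - p) {{pos}}))

-- Induction down to the one coordinate where the two suffixes differ. Earlier coordinates lie in
-- neither suffix, so setting one only raises the weight; the offset `w` records this. At the
-- differing coordinate the strings without it contribute the same `X` to both sides, and those with
-- it contribute `O` and `E`, whose difference is an iterated difference.
recipSum-suffix-< : ∀ {n} j w → j < n →
  recipSum n (λ s → w ℕ.+ halfEig (suffix j) s) <ℚ
  recipSum n (λ s → w ℕ.+ halfEig (suffix (suc j)) s)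
recipSum-suffix-< {suc n} zero w _ = subst₂ _<ℚ_ (sym lhs) (sym rhs) (+-monoʳ-< X O<E)
  where
  X = recipSum n (λ s → w ℕ.+ halfEig (suffix 0) s)
  E = recipSum n (λ s → suc (w ℕ.+ halfEig (suffix 0) s))
  O = recipSum n (λ s → suc (w ℕ.+ complementary (suffix 0) s))
  O<E : O <ℚ E
  O<E = pos-difference⇒< O E (subst Positive (sym (∑-alternating n w)) (Δrecip-pos (suc n) w))
  lhs : recipSum (suc n) (λ s → w ℕ.+ halfEig (suffix 0) s) ≡ X + O
  lhs = trans (recipSum-suc n (λ s → w ℕ.+ halfEig (suffix 0) s))
              (cong (X +_) (recipSum-cong n (λ s → ℕ.+-suc w _)))
  rhs : recipSum (suc n) (λ s → w ℕ.+ halfEig (suffix 1) s) ≡ X + E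
  rhs = trans (recipSum-suc n (λ s → w ℕ.+ halfEig (suffix 1) s))
              (cong (X +_) (recipSum-cong n (λ s → ℕ.+-suc w _)))
recipSum-suffix-< {suc n} (suc j) w (s≤s j<n) = subst₂ _<ℚ_ (sym (split j)) (sym (split (suc j)))
  (+-mono-< (recipSum-suffix-< j w j<n) (recipSum-suffix-< j (suc w) j<n))
  where
  X : ℕ → ℕ → ℚ
  X i w = recipSum n (λ s → w ℕ.+ halfEig (suffix i) s)
  split : ∀ i → recipSum (suc n) (λ s → w ℕ.+ halfEig (suffix (suc i)) s) ≡
                X i w + X i (suc w)
  split i = trans (recipSum-suc n (λ s → w ℕ.+ halfEig (suffix (suc i)) s))
                  (cong (X i w +_) (recipSum-cong n (λ s → ℕ.+-suc w _)))

theorem5 : (n k : ℕ) → 3 ≤ n → 1 ≤ k → suc k < n →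
    (∃ λ r → IsResistanceFn n k r)
    × (∃ λ r → IsResistanceFn n (suc k) r)
    × ((r r′ : Vertex n → Vertex n → ℚ) →
    IsResistanceFn n k r → IsResistanceFn n (suc k) r′ →
    kirchhoff n r <ℚ kirchhoff n r′)
theorem5 n (suc j) _ _ k<n =
    (resistance j j<n , resistance-isResistance j j<n)
  , (resistance (suc j) k<n , resistance-isResistance (suc j) k<n)
  -- The formula gives twice each index, so the factor two is removed by contradiction: adding
  -- `K′≤K` to itself would oppose the strict inequality between the doubled values.
  , λ r r′ isR isR′ → ≰⇒> λ K′≤K → <-irrefl refl (<-≤-trans
      (subst₂ _<ℚ_ (sym (kirchhoff-formula j j<n isR)) (sym (kirchhoff-formula (suc j) k<n isR′))
        (*-monoʳ-<-pos (scale n) {{scale-pos n}} (recipSum-suffix-< j 0 (ℕ.<-trans (ℕ.n<1+n j) j<n))))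
      (+-mono-≤ K′≤K K′≤K))
  where
  j<n : suc j < n
  j<n = ℕ.<-trans (ℕ.n<1+n (suc j)) k<n
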